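{- Let $X$ be a Priestley space and $\mathcal U\subseteq{\sf DM}(X)$. Then the join $\bigvee\mathcal U$ in ${\sf DM}(X)$ is distributive (i.e., $V\cap\bigvee\mathcal U=\bigvee\{V\cap U:U\in\mathcal U\}$ in ${\sf DM}(X)$ for every $V\in{\sf DM}(X)$) if and only if $\bigvee\mathcal U={\sf int_1\,cl}\bigcup\mathcal U$.
   Context: A Priestley space is a compact space $X$ with a partial order $\le$ such that whenever $x\not\le y$ there is a clopen upset containing $x$ but not $y$. ${\sf cl}$, ${\sf int}$ denote closure and interior in the topology of $X$; ${\sf int_1}$ is the interior in the topology of open upsets, ${\sf cl_2}$ the closure in the topology of open downsets; explicitly ${\sf cl_2}(S)={\uparrow}{\sf cl}(S)$ and ${\sf int_1}(S)=X\setminus{\downarrow}(X\setminus{\sf int}(S))$. A DM-set is an open upset $U$ with ${\sf int_1\,cl_2}(U)=U$; ${\sf DM}(X)$ is the complete lattice of DM-sets, with finite meets given by intersection and joins $\bigvee\mathcal U={\sf int_1\,cl_2}(\bigcup\mathcal U)$. -}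

module Defs where

open import Axiom.ExcludedMiddle using (ExcludedMiddle)
open import Data.List.Relation.Unary.All using (All)
open import Data.List.Relation.Unary.Any using (Any)
open import Data.Product.Base using (∃-syntax; _×_; _,_; proj₁; proj₂)
open import Data.Unit.Base using (tt)
open import Function.Base using (flip; _∘_)
open import Level using (Level; 0ℓ; _⊔_) renaming (suc to lsuc)
open import Relation.Binary.Core using (Rel)
open import Relation.Binary.Definitions using (_Respects_)
open import Relation.Binary.PropositionalEquality.Core using (_≡_)
open import Relation.Binary.Structures using (IsPartialOrder)
open import Relation.Nullary using (¬_)
open import Relation.Nullary.Decidable.Core using (True; toWitness; fromWitness)
open import Relation.Unary using (Pred; _∈_; _∉_; _⊆_; _≐_; _∩_; ∁; U)

-- The mathematics is classical, so excluded middle is a parameter.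
module Classical (em : ∀ {ℓ} → ExcludedMiddle ℓ) where

  private variable
    a p r s t u : Level

  -- Excluded middle makes every proposition, in whatever universe, equivalent
  -- to one in Set. This supplies the impredicativity of the classical power
  -- set: Pred X 0ℓ contains every subset of X up to _≐_, and is closed under
  -- unions and intersections of arbitrary families.
  record ⌞_⌟ (P : Set p) : Set where
    constructor squash
    field isTrue : True (em {P = P})

  ⌞_⌟⁺ : {P : Set p} → P → ⌞ P ⌟
  ⌞ x ⌟⁺ = squash (fromWitness x)

  ⌞_⌟⁻ : {P : Set p} → ⌞ P ⌟ → P
  ⌞ x ⌟⁻ = toWitness (⌞_⌟.isTrue x)

  ℘ : Set a → Set (a ⊔ lsuc 0ℓ)
  ℘ X = Pred X 0ℓ

  ⋃ : {X : Set a} → Pred (℘ X) s → ℘ X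
  ⋃ 𝒮 x = ⌞ (∃[ S ] S ∈ 𝒮 × x ∈ S) ⌟

  ⋂ : {X : Set a} → Pred (℘ X) s → ℘ X
  ⋂ 𝒮 x = ⌞ (∀ S → S ∈ 𝒮 → x ∈ S) ⌟

  record Topology (X : Set a) (t : Level) : Set (a ⊔ lsuc 0ℓ ⊔ lsuc t) where
    field
      Open      : Pred (℘ X) t
      open-resp : Open Respects _≐_
      open-U    : Open U
      open-∩    : ∀ {A B} → Open A → Open B → Open (A ∩ B)
      open-⋃    : (𝒮 : Pred (℘ X) 0ℓ) → 𝒮 ⊆ Open → Open (⋃ 𝒮)

    Closed : Pred (℘ X) t
    Closed S = Open (∁ S)

    Clopen : Pred (℘ X) t
    Clopen S = Open S × Closed S

    interior : ℘ X → ℘ X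
    interior S = ⋃ (λ O → Open O × O ⊆ S)

    closure : ℘ X → ℘ X
    closure S = ⋂ (λ C → Closed C × S ⊆ C)

    Compact : Set (a ⊔ lsuc 0ℓ ⊔ t)
    Compact = (𝒮 : Pred (℘ X) 0ℓ) → 𝒮 ⊆ Open → (∀ x → x ∈ ⋃ 𝒮) →
              ∃[ Ss ] All 𝒮 Ss × (∀ x → Any (x ∈_) Ss)

    interior-⊆ : ∀ {S} → interior S ⊆ S
    interior-⊆ x∈ with ⌞ x∈ ⌟⁻
    ... | _ , (_ , O⊆S) , x∈O = O⊆S x∈O

    interior-greatest : ∀ {O S} → Open O → O ⊆ S → O ⊆ interior S
    interior-greatest oO O⊆S x∈O = ⌞ _ , (oO , O⊆S) , x∈O ⌟⁺

    interior-mono : ∀ {S T} → S ⊆ T → interior S ⊆ interior T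
    interior-mono S⊆T x∈ with ⌞ x∈ ⌟⁻
    ... | O , (oO , O⊆S) , x∈O = ⌞ O , (oO , S⊆T ∘ O⊆S) , x∈O ⌟⁺

    interior-open : ∀ S → Open (interior S)
    interior-open S = open-resp {⋃ (λ O → ⌞ Open O × O ⊆ S ⌟)} {interior S}
      ( (λ x∈ → let O , O∈ , x∈O = ⌞ x∈ ⌟⁻ in ⌞ O , ⌞ O∈ ⌟⁻ , x∈O ⌟⁺)
      , (λ x∈ → let O , O∈ , x∈O = ⌞ x∈ ⌟⁻ in ⌞ O , ⌞ O∈ ⌟⁺ , x∈O ⌟⁺) )
      (open-⋃ (λ O → ⌞ Open O × O ⊆ S ⌟) (λ O∈ → proj₁ ⌞ O∈ ⌟⁻))

    closure-⊇ : ∀ {S} → S ⊆ closure S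
    closure-⊇ x∈S = ⌞ (λ _ (_ , S⊆C) → S⊆C x∈S) ⌟⁺

    closure-mono : ∀ {S T} → S ⊆ T → closure S ⊆ closure T
    closure-mono S⊆T x∈ = ⌞ (λ C (cC , T⊆C) → ⌞ x∈ ⌟⁻ C (cC , T⊆C ∘ S⊆T)) ⌟⁺

    closure-idem : ∀ {S} → closure (closure S) ⊆ closure S
    closure-idem x∈ =
      ⌞ (λ C C∈ → ⌞ x∈ ⌟⁻ C (proj₁ C∈ , λ y∈ → ⌞ y∈ ⌟⁻ C C∈)) ⌟⁺

  -- With R = _≤_ this is the topology of open upsets, with R = flip _≤_ that
  -- of open downsets.
  openRespecting : {X : Set a} → Topology X t → Rel X r → Topology X (a ⊔ r ⊔ t)
  openRespecting τ R = record
    { Open      = λ S → Open S × S Respects R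
    ; open-resp = λ (S⊆T , T⊆S) (oS , rS) →
        open-resp (S⊆T , T⊆S) oS , λ xRy x∈T → S⊆T (rS xRy (T⊆S x∈T))
    ; open-U    = open-U , λ _ _ → tt
    ; open-∩    = λ (oA , rA) (oB , rB) →
        open-∩ oA oB , λ xRy (x∈A , x∈B) → rA xRy x∈A , rB xRy x∈B
    ; open-⋃    = λ 𝒮 𝒮⊆ →
        open-⋃ 𝒮 (λ S∈ → proj₁ (𝒮⊆ S∈)) ,
        λ xRy x∈ → let S , S∈ , x∈S = ⌞ x∈ ⌟⁻ in
                   ⌞ S , S∈ , proj₂ (𝒮⊆ S∈) xRy x∈S ⌟⁺
    }
    where open Topology τ

  record PriestleySpace (a r t : Level)
         : Set (lsuc (a ⊔ r ⊔ t) ⊔ lsuc (lsuc 0ℓ)) where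
    infix 4 _≤_
    field
      Carrier        : Set a
      _≤_            : Rel Carrier r
      isPartialOrder : IsPartialOrder _≡_ _≤_
      topology       : Topology Carrier t

    open Topology topology public using (Open; Closed; Clopen; Compact)

    IsUpset : Pred (℘ Carrier) (a ⊔ r)
    IsUpset S = S Respects _≤_

    field
      compact    : Compact
      separation : ∀ {x y} → ¬ (x ≤ y) →
                   ∃[ A ] Clopen A × IsUpset A × x ∈ A × y ∉ A

    openUpsets : Topology Carrier (a ⊔ r ⊔ t)
    openUpsets = openRespecting topology _≤_

    openDownsets : Topology Carrier (a ⊔ r ⊔ t)
    openDownsets = openRespecting topology (flip _≤_)

    cl int₁ cl₂ : ℘ Carrier → ℘ Carrier
    cl   = Topology.closure topology
    int₁ = Topology.interior openUpsets
    cl₂  = Topology.closure openDownsets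

  module DMSets (X : PriestleySpace a r t) where
    open PriestleySpace X

    private
      module Up   = Topology openUpsets
      module Down = Topology openDownsets

    record DM : Set (a ⊔ r ⊔ t ⊔ lsuc 0ℓ) where
      field
        set     : ℘ Carrier
        isOpen  : Open set
        isUpset : IsUpset set
        regular : int₁ (cl₂ set) ≐ set

    open DM public using (set)

    infix  4 _≈_ _⊑_
    infixr 7 _∧_

    _≈_ : Rel DM a
    V ≈ W = set V ≐ set W

    _⊑_ : Rel DM a
    V ⊑ W = set V ⊆ set W

    private
      ⊆int₁cl₂ : ∀ {O} → Open O → IsUpset O → O ⊆ int₁ (cl₂ O)
      ⊆int₁cl₂ oO uO = Up.interior-greatest (oO , uO) Down.closure-⊇

      int₁cl₂-mono : ∀ {S T} → S ⊆ T → int₁ (cl₂ S) ⊆ int₁ (cl₂ T)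
      int₁cl₂-mono S⊆T = Up.interior-mono (Down.closure-mono S⊆T)

    _∧_ : DM → DM → DM
    V ∧ W = record
      { set     = set V ∩ set W
      ; isOpen  = proj₁ ou
      ; isUpset = proj₂ ou
      ; regular =
          (λ x∈ → proj₁ (DM.regular V) (int₁cl₂-mono proj₁ x∈)
                , proj₁ (DM.regular W) (int₁cl₂-mono proj₂ x∈))
          , ⊆int₁cl₂ (proj₁ ou) (proj₂ ou)
      }
      where
      ou = Up.open-∩ (DM.isOpen V , DM.isUpset V) (DM.isOpen W , DM.isUpset W)

    ⋃ᴰ : Pred DM u → ℘ Carrier
    ⋃ᴰ 𝒰 x = ⌞ (∃[ V ] V ∈ 𝒰 × x ∈ set V) ⌟

    ⋁ : Pred DM u → DM
    ⋁ 𝒰 = record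
      { set     = int₁ (cl₂ (⋃ᴰ 𝒰))
      ; isOpen  = proj₁ ou
      ; isUpset = proj₂ ou
      ; regular =
          (λ x∈ → Up.interior-mono Down.closure-idem
                    (int₁cl₂-mono Up.interior-⊆ x∈))
          , ⊆int₁cl₂ (proj₁ ou) (proj₂ ou)
      }
      where ou = Up.interior-open (cl₂ (⋃ᴰ 𝒰))

    ⋁-upper : (𝒰 : Pred DM u) → ∀ {V} → V ∈ 𝒰 → V ⊑ ⋁ 𝒰
    ⋁-upper 𝒰 {V} V∈ x∈ =
      int₁cl₂-mono (λ y∈ → ⌞ V , V∈ , y∈ ⌟⁺) (proj₂ (DM.regular V) x∈)

    ⋁-least : (𝒰 : Pred DM u) → ∀ {W} → (∀ {V} → V ∈ 𝒰 → V ⊑ W) → ⋁ 𝒰 ⊑ W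
    ⋁-least 𝒰 {W} ub x∈ = proj₁ (DM.regular W)
      (int₁cl₂-mono {⋃ᴰ 𝒰} {set W}
        (λ y∈ → let V , V∈ , y∈V = ⌞ y∈ ⌟⁻ in ub V∈ y∈V) x∈)

    _∧[_] : DM → Pred DM u → Pred DM (a ⊔ r ⊔ t ⊔ lsuc 0ℓ ⊔ u)
    V ∧[ 𝒰 ] = λ W → ∃[ V′ ] V′ ∈ 𝒰 × W ≈ (V ∧ V′)

    DistributiveJoin : Pred DM u → Set (a ⊔ r ⊔ t ⊔ lsuc 0ℓ)
    DistributiveJoin 𝒰 = ∀ V → (V ∧ ⋁ 𝒰) ≈ ⋁ (V ∧[ 𝒰 ])

{-# OPTIONS --safe #-}
-- Write S for ⋃ 𝒰. The inclusion int₁ (cl S) ⊆ ⋁ 𝒰 always holds, and an open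
-- V satisfies V ∩ cl S ⊆ cl (V ∩ S), so ⋁ 𝒰 ⊆ cl S makes the join
-- distributive. Conversely, let x ∈ ⋁ 𝒰 lie outside a closed C ⊇ S.
-- Compactness gives a DM-set V and an open downset B, both containing x, with
-- V ∩ B disjoint from C. Then V ∩ S lies in the closed upset ∁ B, hence so
-- does the join of the V ∧ U with U ∈ 𝒰, which therefore misses
-- x ∈ V ∩ ⋁ 𝒰.
module Submission where

open import Defs
open import Axiom.ExcludedMiddle using (ExcludedMiddle)
open import Data.List.Base using (List)
open import Data.List.Relation.Unary.All using (All; []; _∷_)
open import Data.List.Relation.Unary.Any using (Any; here; there)
open import Data.Product.Base using (∃-syntax; _×_; _,_; proj₁; proj₂)
open import Data.Unit.Base using (tt)
open import Function.Bundles using (_⇔_; mk⇔)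
open import Level using (Level; 0ℓ; _⊔_) renaming (suc to lsuc)
open import Relation.Binary.PropositionalEquality using (subst)
open import Relation.Binary.Structures using (IsPartialOrder)
open import Relation.Nullary using (yes; no)
open import Relation.Nullary.Decidable using (decidable-stable)
open import Relation.Unary using (Pred; _∈_; _∉_; _⊆_; _≐_; _∩_; ∁; U)

module _ (em : ∀ {ℓ} → ExcludedMiddle ℓ) where

  open Classical em

  private variable
    a r s t u : Level

  module _ {X : Set a} (τ : Topology X t) where
    open Topology τ

    -- If `x` in `O` avoided a closed `C` containing `O ∩ S`, then `O ∩ ∁ C` would be a
    -- neighbourhood of `x` disjoint from `S`.
    open∩closure⊆closure∩ : ∀ {O S} → Open O → O ∩ closure S ⊆ closure (O ∩ S)
    open∩closure⊆closure∩ {O} oO {x} (x∈O , x∈clS) =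
      ⌞ (λ C (cC , O∩S⊆C) → decidable-stable em λ x∉C →
          ⌞ x∈clS ⌟⁻ (∁ (O ∩ ∁ C))
            -- Closedness of a complement is openness of a double complement, which excluded middle
            -- collapses.
            ( open-resp ( (λ y∈ k → k y∈) , decidable-stable em )
                        (open-∩ oO cC)
            , λ y∈S (y∈O , y∉C) → y∉C (O∩S⊆C (y∈O , y∈S)) )
            (x∈O , x∉C)) ⌟⁺

  module _ (X : PriestleySpace a r t) where
    open PriestleySpace X
    open DMSets X

    private
      module Top  = Topology topology
      module Up   = Topology openUpsets
      module Down = Topology openDownsets

    closedUpset⇒Down-closed : ∀ {S} → Closed S → IsUpset S → Down.Closed S
    closedUpset⇒Down-closed cS uS = cS , λ y≤x x∉S y∈S → x∉S (uS y≤x y∈S)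

    cl⊆cl₂ : ∀ {S} → cl S ⊆ cl₂ S
    cl⊆cl₂ x∈ = ⌞ (λ C (cC , S⊆C) → ⌞ x∈ ⌟⁻ C (proj₁ cC , S⊆C)) ⌟⁺

    -- A closed upset equals its own `cl₂`, and an open upset its own `int₁`.
    clopenUpset : ∀ {A} → Clopen A → IsUpset A → DM
    clopenUpset {A} (oA , cA) uA = record
      { set     = A
      ; isOpen  = oA
      ; isUpset = uA
      ; regular =
          (λ x∈ → ⌞ Up.interior-⊆ x∈ ⌟⁻ A
                    (closedUpset⇒Down-closed cA uA , λ y∈ → y∈))
          , Up.interior-greatest (oA , uA) Down.closure-⊇
      }

    ⊤ᴰ : DM
    ⊤ᴰ = record
      { set     = U
      ; isOpen  = Top.open-U
      ; isUpset = λ _ _ → tt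
      ; regular = (λ _ → tt) , Up.interior-greatest Up.open-U Down.closure-⊇
      }

    -- `V` has to be a DM-set because distributivity will be applied to it; `B` is an open downset
    -- so that `∁ B` can bound a `cl₂`.
    Separated : Carrier → Pred Carrier s → Set (a ⊔ r ⊔ t ⊔ s ⊔ lsuc 0ℓ)
    Separated x S = ∃[ V ] ∃[ B ] x ∈ set V × Down.Open B × x ∈ B ×
                      set V ∩ B ⊆ ∁ S

    -- DM-sets and open downsets are both closed under finite intersection, and intersecting
    -- preserves every disjointness already obtained.
    separated-Any : ∀ {x} {C : ℘ Carrier} {Ss : List (℘ Carrier)} →
                    All (λ S → Separated x (S ∩ C)) Ss →
                    Separated x ((λ y → Any (y ∈_) Ss) ∩ C)
    separated-Any [] =
      ⊤ᴰ , U , tt , Down.open-U , tt , λ { _ (() , _) }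
    separated-Any ((V , B , x∈V , oB , x∈B , disj) ∷ seps) =
      let V′ , B′ , x∈V′ , oB′ , x∈B′ , disj′ = separated-Any seps in
      V ∧ V′ , B ∩ B′ , (x∈V , x∈V′) , Down.open-∩ oB oB′ , (x∈B , x∈B′) ,
      λ { ((y∈V , _) , y∈B , _) (here y∈S , y∈C) →
            disj (y∈V , y∈B) (y∈S , y∈C)
        ; ((_ , y∈V′) , _ , y∈B′) (there y∈ , y∈C) →
            disj′ (y∈V′ , y∈B′) (y∈ , y∈C) }

    separated-closed : ∀ {x C} → Closed C → x ∉ C → Separated x C
    separated-closed {x} {C} cC x∉C =
      let Ss , Ss∈𝒮 , covers = compact 𝒮 (λ S∈ → proj₁ ⌞ S∈ ⌟⁻) 𝒮-covers
          V , B , x∈V , oB , x∈B , disj = separated-Any (unsquash Ss∈𝒮)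
      in V , B , x∈V , oB , x∈B , λ y∈ y∈C → disj y∈ (covers _ , y∈C)
      where
      -- Covering the whole space by sets with separated trace on `C` lets compactness apply
      -- directly, without passing to the subspace `C`.
      𝒮 : ℘ (℘ Carrier)
      𝒮 S = ⌞ Open S × Separated x (S ∩ C) ⌟

      unsquash : ∀ {Ss} → All 𝒮 Ss → All (λ S → Separated x (S ∩ C)) Ss
      unsquash []         = []
      unsquash (S∈ ∷ Ss∈) = proj₂ ⌞ S∈ ⌟⁻ ∷ unsquash Ss∈

      𝒮-covers : ∀ y → y ∈ ⋃ 𝒮
      𝒮-covers y with em {P = x ≤ y} | em {P = y ≤ x}
      -- Here `y` has the neighbourhood `∁ A`, and the clopen upset `A` around `x` serves as `V`.
      ... | no x≰y | _ =
        let A , (oA , cA) , uA , x∈A , y∉A = separation x≰y in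
        ⌞ ∁ A
        , ⌞ cA , clopenUpset (oA , cA) uA , U , x∈A , Down.open-U , tt
          , (λ (z∈A , _) (z∉A , _) → z∉A z∈A) ⌟⁺
        , y∉A ⌟⁺
      -- With the order reversed, `A` is the neighbourhood of `y` and the open downset `∁ A` around
      -- `x` serves as `B`.
      ... | yes _ | no y≰x =
        let A , (oA , cA) , uA , y∈A , x∉A = separation y≰x in
        ⌞ A
        , ⌞ oA , ⊤ᴰ , ∁ A , tt , closedUpset⇒Down-closed cA uA , x∉A
          , (λ (_ , z∉A) (z∈A , _) → z∉A z∈A) ⌟⁺
        , y∈A ⌟⁺
      -- Now `y` is `x`, which lies outside `C`; the neighbourhood `∁ C` has empty trace on `C`.
      ... | yes x≤y | yes y≤x =
        ⌞ ∁ C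
        , ⌞ cC , ⊤ᴰ , U , tt , Down.open-U , tt
          , (λ _ (z∉C , z∈C) → z∉C z∈C) ⌟⁺
        , subst (_∉ C) (IsPartialOrder.antisym isPartialOrder x≤y y≤x) x∉C ⌟⁺

    module _ (𝒰 : Pred DM u) where

      int₁cl⊆⋁ : int₁ (cl (⋃ᴰ 𝒰)) ⊆ set (⋁ 𝒰)
      int₁cl⊆⋁ = Up.interior-mono cl⊆cl₂

      ⋁∧⊑∧⋁ : ∀ V → ⋁ (V ∧[ 𝒰 ]) ⊑ V ∧ ⋁ 𝒰
      ⋁∧⊑∧⋁ V = ⋁-least (V ∧[ 𝒰 ]) {V ∧ ⋁ 𝒰}
        λ (W , W∈ , ≈V∧W) y∈ →
          let y∈V , y∈W = proj₁ ≈V∧W y∈ in y∈V , ⋁-upper 𝒰 {W} W∈ y∈W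

      ∩⋃⊆⋃∧ : ∀ V → set V ∩ ⋃ᴰ 𝒰 ⊆ ⋃ᴰ (V ∧[ 𝒰 ])
      ∩⋃⊆⋃∧ V (y∈V , y∈) =
        let W , W∈ , y∈W = ⌞ y∈ ⌟⁻ in
        ⌞ V ∧ W , (W , W∈ , (λ z∈ → z∈) , λ z∈ → z∈) , (y∈V , y∈W) ⌟⁺

      ⋃∧⊆∩⋃ : ∀ V → ⋃ᴰ (V ∧[ 𝒰 ]) ⊆ set V ∩ ⋃ᴰ 𝒰
      ⋃∧⊆∩⋃ V y∈ =
        let _ , (W , W∈ , ≈V∧W) , y∈V∧W = ⌞ y∈ ⌟⁻
            y∈V , y∈W = proj₁ ≈V∧W y∈V∧W
        in y∈V , ⌞ W , W∈ , y∈W ⌟⁺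

      ⋁⊆cl⇒distributive : set (⋁ 𝒰) ⊆ cl (⋃ᴰ 𝒰) → DistributiveJoin 𝒰
      ⋁⊆cl⇒distributive ⋁⊆cl V =
        -- The meet is an open upset, so lying inside `cl₂` already puts it inside `int₁` of that
        -- closure.
        Up.interior-greatest (DM.isOpen (V ∧ ⋁ 𝒰) , DM.isUpset (V ∧ ⋁ 𝒰))
          (λ (x∈V , x∈⋁) →
            Down.closure-mono (∩⋃⊆⋃∧ V)
              (cl⊆cl₂ (open∩closure⊆closure∩ topology {set V} (DM.isOpen V)
                (x∈V , ⋁⊆cl x∈⋁))))
        , ⋁∧⊑∧⋁ V

      distributive⇒⋁⊆cl : DistributiveJoin 𝒰 → set (⋁ 𝒰) ⊆ cl (⋃ᴰ 𝒰)
      distributive⇒⋁⊆cl dist x∈⋁ =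
        ⌞ (λ C (cC , ⋃⊆C) → decidable-stable em λ x∉C →
            let V , B , x∈V , oB , x∈B , disj = separated-closed cC x∉C in
            -- Distributivity puts `x` in `cl₂ (⋃ᴰ (V ∧[ 𝒰 ]))`, hence in `∁ B`, contradicting
            -- `x ∈ B`.
            ⌞ Up.interior-⊆ (proj₁ (dist V) (x∈V , x∈⋁)) ⌟⁻ (∁ B)
              ( Down.open-resp ((λ y∈B k → k y∈B) , decidable-stable em) oB
              , λ y∈ y∈B → let y∈V , y∈⋃ = ⋃∧⊆∩⋃ V y∈ in
                           disj (y∈V , y∈B) (⋃⊆C y∈⋃) )
              x∈B) ⌟⁺

      distributive⇒≐ : DistributiveJoin 𝒰 → set (⋁ 𝒰) ≐ int₁ (cl (⋃ᴰ 𝒰))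
      distributive⇒≐ dist =
        Up.interior-greatest (DM.isOpen (⋁ 𝒰) , DM.isUpset (⋁ 𝒰))
          (distributive⇒⋁⊆cl dist)
        , int₁cl⊆⋁

      ≐⇒distributive : set (⋁ 𝒰) ≐ int₁ (cl (⋃ᴰ 𝒰)) → DistributiveJoin 𝒰
      ≐⇒distributive (⋁⊆int₁cl , _) =
        ⋁⊆cl⇒distributive (λ x∈ → Up.interior-⊆ (⋁⊆int₁cl x∈))

theorem5p5 : ∀ {a r t u} (em : ∀ {ℓ} → ExcludedMiddle ℓ) →
    let open Classical em in
    (X : PriestleySpace a r t) →
    let open PriestleySpace X
        open DMSets X in
    (𝒰 : Pred DM u) →
    DistributiveJoin 𝒰 ⇔ (set (⋁ 𝒰) ≐ int₁ (cl (⋃ᴰ 𝒰)))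
theorem5p5 em X 𝒰 = mk⇔ (distributive⇒≐ em X 𝒰) (≐⇒distributive em X 𝒰)
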